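{- Let $n \ge 1$ and let $T_1=([n], E_1)$ and $T_2=([n], E_2)$ be two tournaments on the same vertex set $[n]$. Then there is a vertex $\mu \in [n]$ such that $i \Rightarrow \mu$ for every $i \in [n]$; that is, for every $i\in[n]$ at least one of the following holds: $i=\mu$, or $(i,\mu)\in E_1$, or $(i,\mu)\in E_2$, or there exists $k\in[n]$ with $(i,k)\in E_1$ and $(k,\mu)\in E_2$.
   Context: $[n]=\{1,\dots,n\}$. A tournament $T=([n],E)$ is a directed graph without loops on vertex set $[n]$ such that for every two distinct vertices $i,j$ exactly one of $(i,j)$, $(j,i)$ belongs to $E$. The tournaments $T_1$ and $T_2$ are arbitrary and need not be related. For $i,j\in[n]$, the relation $i\Rightarrow j$ (with respect to the ordered pair $(T_1,T_2)$) means: $i=j$, or $(i,j)\in E_1$, or $(i,j)\in E_2$, or there exists $k$ such that $(i,k)\in E_1$ and $(k,j)\in E_2$. -}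

module Defs where

open import Data.Fin using (Fin)
open import Data.Nat using (ℕ)
open import Data.Product using (∃-syntax; _×_)
open import Data.Sum using (_⊎_)
open import Level using (0ℓ)
open import Relation.Binary using (Rel; Irreflexive)
open import Relation.Binary.PropositionalEquality using (_≡_; _≢_)
open import Relation.Nullary using (¬_)

-- The vertex set [n] = {1,…,n} is represented by Fin n.  Together with
-- decidable equality on Fin n, the two fields make E decidable.
record Tournament (n : ℕ) : Set₁ where
  field
    E          : Rel (Fin n) 0ℓ
    loopless   : Irreflexive _≡_ E
    exactlyOne : ∀ {i j} → i ≢ j → (E i j × ¬ E j i) ⊎ (¬ E i j × E j i)

open Tournament public using (E)

infix 4 _[_,_]⇒_

_[_,_]⇒_ : ∀ {n} → Fin n → Tournament n → Tournament n → Fin n → Set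
i [ T₁ , T₂ ]⇒ j =
  i ≡ j ⊎ E T₁ i j ⊎ E T₂ i j ⊎ (∃[ k ] (E T₁ i k × E T₂ k j))

{-# OPTIONS --safe #-}
-- By induction on the number of vertices, for every vertex v some g v is
-- reached by ⇒ from all vertices other than v.  If v ⇒ g v for some v, then
-- g v is the required vertex.  Otherwise v is the only vertex with v ⇏ g v,
-- so g is injective, hence a permutation.  Moreover v ⇏ g v says that v and all
-- its T₁-out-neighbours are T₂-out-neighbours of g v, so the outdegree of v in
-- T₁ is less than that of g v in T₂.  Summing over v contradicts the fact that
-- T₁ and T₂ have the same number of edges.

module Submission where

open import Defs
import Algebra.Properties.CommutativeMonoid.Sum
open import Data.Fin using (Fin; zero; suc; punchIn; punchOut)
open import Data.Fin.Properties
  using (_≟_; any?; punchIn-injective; punchOut-injective; punchIn-punchOut; suc-injective; 0≢1+n)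
open import Data.Nat using (ℕ; zero; suc; _+_; _≤_; _<_; _≥_; z≤n; s≤s)
open import Data.Nat.Properties
  using (+-0-commutativeMonoid; +-mono-≤; +-monoʳ-≤; +-mono-<; +-mono-<-≤; +-mono-≤-<; <⇒≤;
         <-irrefl; ≤-refl; module ≤-Reasoning)
open import Data.Product using (∃-syntax; _,_; proj₁; proj₂)
open import Data.Sum using (inj₁; inj₂)
open import Data.Vec.Functional using (Vector; removeAt)
open import Function using (_∘_)
open import Function.Definitions using (Injective)
open import Relation.Binary using (Decidable)
open import Relation.Binary.PropositionalEquality
  using (_≡_; _≢_; refl; sym; trans; cong; subst; module ≡-Reasoning)
open import Relation.Nullary
  using (¬_; Dec; yes; no; contradiction; ¬?; _×-dec_; _⊎-dec_)
open Algebra.Properties.CommutativeMonoid.Sum +-0-commutativeMonoid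
  using (sum; sum-syntax; sum-cong-≗; sum-remove; ∑-comm; ∑-distrib-+)

sum-mono-≤ : ∀ {n} {f g : Vector ℕ n} → (∀ i → f i ≤ g i) → sum f ≤ sum g
sum-mono-≤ {zero}  f≤g = z≤n
sum-mono-≤ {suc n} f≤g = +-mono-≤ (f≤g zero) (sum-mono-≤ (f≤g ∘ suc))

sum-mono-< : ∀ {n} {f g : Vector ℕ n} → (∀ i → f i ≤ g i) →
             ∀ i → f i < g i → sum f < sum g
sum-mono-< f≤g zero    fᵢ<gᵢ = +-mono-<-≤ fᵢ<gᵢ (sum-mono-≤ (f≤g ∘ suc))
sum-mono-< f≤g (suc i) fᵢ<gᵢ = +-mono-≤-< (f≤g zero) (sum-mono-< (f≤g ∘ suc) i fᵢ<gᵢ)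

sum-injective-≤ : ∀ {m n} (f : Vector ℕ n) {g : Fin m → Fin n} →
                  Injective _≡_ _≡_ g → sum (f ∘ g) ≤ sum f
sum-injective-≤ {zero}          f g-inj = z≤n
sum-injective-≤ {suc m} {zero}  f {g} g-inj with () ← g zero
sum-injective-≤ {suc m} {suc n} f {g} g-inj = begin
  f g₀ + sum (f ∘ g ∘ suc)         ≡⟨ cong (f g₀ +_) (sum-cong-≗ λ j → cong f (sym (punchIn-punchOut (g₀≢ j)))) ⟩
  f g₀ + sum (removeAt f g₀ ∘ h)   ≤⟨ +-monoʳ-≤ (f g₀) (sum-injective-≤ (removeAt f g₀) h-inj) ⟩
  f g₀ + sum (removeAt f g₀)       ≡⟨ sum-remove f ⟨
  sum f                            ∎
  where
  open ≤-Reasoning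
  g₀ = g zero
  g₀≢ : ∀ j → g₀ ≢ g (suc j)
  g₀≢ j = 0≢1+n ∘ g-inj
  h : Fin m → Fin n
  h j = punchOut (g₀≢ j)
  h-inj : Injective _≡_ _≡_ h
  h-inj = suc-injective ∘ g-inj ∘ punchOut-injective (g₀≢ _) (g₀≢ _)

indicator : ∀ {a} {A : Set a} → Dec A → ℕ
indicator (yes _) = 1
indicator (no  _) = 0

indicator-mono-≤ : ∀ {a b} {A : Set a} {B : Set b} (a? : Dec A) (b? : Dec B) →
                   (A → B) → indicator a? ≤ indicator b?
indicator-mono-≤ (yes a) (yes _) A→B = ≤-refl
indicator-mono-≤ (yes a) (no ¬b) A→B = contradiction (A→B a) ¬b
indicator-mono-≤ (no _)  b?      A→B = z≤n

indicator-mono-< : ∀ {a b} {A : Set a} {B : Set b} (a? : Dec A) (b? : Dec B) →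
                   ¬ A → B → indicator a? < indicator b?
indicator-mono-< (yes a) b?      ¬a b = contradiction a ¬a
indicator-mono-< (no _)  (yes _) ¬a b = ≤-refl
indicator-mono-< (no _)  (no ¬b) ¬a b = contradiction b ¬b

module _ {n} (T : Tournament n) where
  open Tournament T using (loopless; exactlyOne)

  E-total : ∀ {i j} → i ≢ j → ¬ E T i j → E T j i
  E-total i≢j ¬Eij with exactlyOne i≢j
  ... | inj₁ (Eij , _) = contradiction Eij ¬Eij
  ... | inj₂ (_ , Eji) = Eji

  E? : Decidable (E T)
  E? i j with i ≟ j
  ... | yes i≡j = no (loopless i≡j)
  ... | no  i≢j with exactlyOne i≢j
  ...   | inj₁ (Eij , _)  = yes Eij
  ...   | inj₂ (¬Eij , _) = no ¬Eij

  outdegree : Vector ℕ n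
  outdegree i = ∑[ j < n ] indicator (E? i j)

  indicator-E-+ : ∀ {i j} (Eij? : Dec (E T i j)) (Eji? : Dec (E T j i)) (i≡j? : Dec (i ≡ j)) →
                  indicator Eij? + indicator Eji? ≡ indicator (¬? i≡j?)
  indicator-E-+ (yes Eij) _         (yes i≡j) = contradiction Eij (loopless i≡j)
  indicator-E-+ (no _)    (yes Eji) (yes i≡j) = contradiction Eji (loopless (sym i≡j))
  indicator-E-+ (no _)    (no _)    (yes _)   = refl
  indicator-E-+ (yes _)   (no _)    (no _)    = refl
  indicator-E-+ (no _)    (yes _)   (no _)    = refl
  indicator-E-+ (no ¬Eij) (no ¬Eji) (no i≢j)  = contradiction (E-total i≢j ¬Eij) ¬Eji
  indicator-E-+ (yes Eij) (yes Eji) (no i≢j) with exactlyOne i≢j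
  ... | inj₁ (_ , ¬Eji) = contradiction Eji ¬Eji
  ... | inj₂ (¬Eij , _) = contradiction Eij ¬Eij

  handshake : sum outdegree + sum outdegree ≡ ∑[ i < n ] ∑[ j < n ] indicator (¬? (i ≟ j))
  handshake = begin
    sum outdegree + sum outdegree
      ≡⟨ cong (sum outdegree +_) (∑-comm λ i j → indicator (E? i j)) ⟩
    sum outdegree + ∑[ i < n ] ∑[ j < n ] indicator (E? j i)
      ≡⟨ ∑-distrib-+ outdegree _ ⟨
    ∑[ i < n ] (outdegree i + ∑[ j < n ] indicator (E? j i))
      ≡⟨ sum-cong-≗ (λ i → sym (∑-distrib-+ (λ j → indicator (E? i j)) _)) ⟩
    ∑[ i < n ] ∑[ j < n ] (indicator (E? i j) + indicator (E? j i))
      ≡⟨ sum-cong-≗ (λ i → sum-cong-≗ (λ j → indicator-E-+ (E? i j) (E? j i) (i ≟ j))) ⟩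
    ∑[ i < n ] ∑[ j < n ] indicator (¬? (i ≟ j))
      ∎
    where open ≡-Reasoning

pullback : ∀ {m n} (f : Fin m → Fin n) → Injective _≡_ _≡_ f → Tournament n → Tournament m
pullback f f-inj T = record
  { E          = λ i j → E T (f i) (f j)
  ; loopless   = loopless ∘ cong f
  ; exactlyOne = λ i≢j → exactlyOne (i≢j ∘ f-inj)
  }
  where open Tournament T using (loopless; exactlyOne)

remove : ∀ {n} → Fin (suc n) → Tournament (suc n) → Tournament n
remove v = pullback (punchIn v) (punchIn-injective v _ _)

remove-⇒ : ∀ {n} v (T₁ T₂ : Tournament (suc n)) {i j} →
           i [ remove v T₁ , remove v T₂ ]⇒ j → punchIn v i [ T₁ , T₂ ]⇒ punchIn v j
remove-⇒ v T₁ T₂ (inj₁ i≡j)                            = inj₁ (cong (punchIn v) i≡j)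
remove-⇒ v T₁ T₂ (inj₂ (inj₁ Eij))                     = inj₂ (inj₁ Eij)
remove-⇒ v T₁ T₂ (inj₂ (inj₂ (inj₁ Eij)))              = inj₂ (inj₂ (inj₁ Eij))
remove-⇒ v T₁ T₂ (inj₂ (inj₂ (inj₂ (k , Eik , Ekj)))) = inj₂ (inj₂ (inj₂ (punchIn v k , Eik , Ekj)))

module _ {n} (T₁ T₂ : Tournament n) where

  ⇒? : Decidable (_[ T₁ , T₂ ]⇒_)
  ⇒? i j = (i ≟ j) ⊎-dec E? T₁ i j ⊎-dec E? T₂ i j ⊎-dec any? (λ k → E? T₁ i k ×-dec E? T₂ k j)

  ⇏⇒outdegree< : ∀ {i j} → ¬ i [ T₁ , T₂ ]⇒ j → outdegree T₁ i < outdegree T₂ j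
  ⇏⇒outdegree< {i} {j} i⇏j = sum-mono-<
    (λ k → indicator-mono-≤ (E? T₁ i k) (E? T₂ j k) N₁[i]⊆N₂[j])
    i (indicator-mono-< (E? T₁ i i) (E? T₂ j i) (Tournament.loopless T₁ refl)
        (E-total T₂ (i⇏j ∘ inj₁) (i⇏j ∘ inj₂ ∘ inj₂ ∘ inj₁)))
    where
    N₁[i]⊆N₂[j] : ∀ {k} → E T₁ i k → E T₂ j k
    N₁[i]⊆N₂[j] {k} Eik = E-total T₂
      (λ { refl → i⇏j (inj₂ (inj₁ Eik)) })
      (λ Ekj → i⇏j (inj₂ (inj₂ (inj₂ (k , Eik , Ekj)))))

  injective-⇏-absurd : Fin n → {g : Fin n → Fin n} → Injective _≡_ _≡_ g →
                       ¬ (∀ v → ¬ v [ T₁ , T₂ ]⇒ g v)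
  injective-⇏-absurd v₀ {g} g-inj v⇏gv =
    <-irrefl (trans (handshake T₁) (sym (handshake T₂))) (+-mono-< sum< sum<)
    where
    open ≤-Reasoning
    sum< : sum (outdegree T₁) < sum (outdegree T₂)
    sum< = begin-strict
      sum (outdegree T₁)       <⟨ sum-mono-< (<⇒≤ ∘ ⇏⇒outdegree< ∘ v⇏gv) v₀ (⇏⇒outdegree< (v⇏gv v₀)) ⟩
      sum (outdegree T₂ ∘ g)   ≤⟨ sum-injective-≤ (outdegree T₂) g-inj ⟩
      sum (outdegree T₂)       ∎

  exceptional⇒μ : Fin n → (g : Fin n → Fin n) → (∀ {v i} → v ≢ i → i [ T₁ , T₂ ]⇒ g v) →
                  ∃[ μ ] (∀ i → i [ T₁ , T₂ ]⇒ μ)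
  exceptional⇒μ v₀ g ⇒g with any? (λ v → ⇒? v (g v))
  ... | no ∄v = contradiction (λ v v⇒gv → ∄v (v , v⇒gv)) (injective-⇏-absurd v₀ g-inj)
    where
    g-inj : Injective _≡_ _≡_ g
    g-inj {v} {w} gv≡gw with v ≟ w
    ... | yes v≡w = v≡w
    ... | no  v≢w = contradiction (w , subst (w [ T₁ , T₂ ]⇒_) gv≡gw (⇒g v≢w)) ∄v
  ... | yes (v , v⇒gv) = g v , ⇒gv
    where
    ⇒gv : ∀ i → i [ T₁ , T₂ ]⇒ g v
    ⇒gv i with v ≟ i
    ... | yes refl = v⇒gv
    ... | no  v≢i  = ⇒g v≢i

extend-from-removals : ∀ {n} (T₁ T₂ : Tournament (suc n)) →
  (∀ v → ∃[ μ ] (∀ i → i [ remove v T₁ , remove v T₂ ]⇒ μ)) →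
  ∃[ μ ] (∀ i → i [ T₁ , T₂ ]⇒ μ)
extend-from-removals T₁ T₂ IH =
  exceptional⇒μ T₁ T₂ zero (λ v → punchIn v (proj₁ (IH v))) λ {v} v≢i →
    subst (_[ T₁ , T₂ ]⇒ _) (punchIn-punchOut v≢i)
      (remove-⇒ v T₁ T₂ (proj₂ (IH v) (punchOut v≢i)))

corollary2 : (n : ℕ) → n ≥ 1 → (T₁ T₂ : Tournament n) →
    ∃[ μ ] ((i : Fin n) → i [ T₁ , T₂ ]⇒ μ)
corollary2 (suc zero)      _ T₁ T₂ = zero , λ { zero → inj₁ refl }
corollary2 (suc n@(suc _)) _ T₁ T₂ =
  extend-from-removals T₁ T₂ λ v → corollary2 n (s≤s z≤n) (remove v T₁) (remove v T₂)
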